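{- Let $\mathcal C$ be a class of functions $M\colon G\to\mathbb C$ such that if $M,N\in\mathcal C$, then $M+\alpha N\in\mathcal C$ for every $\alpha\in\mathbb C$. If $M\in\mathcal C$ is such that $\beta(M)\ge\beta(N)$ for each $N\in\mathcal C$, then $M$ must also satisfy $$\Psi_M\overline{\Psi_{M,N}}=\Psi_N\Psi_{M,M}\quad\text{for each }N\in\mathcal C.$$
   Context: $G$ is an (indexing) set, $L\colon G\to\mathbb C$ is a function, and $w\colon G\to[0,\infty)$ is a weight function, not identically $0$. For $f\colon G\to\mathbb C$ put $\mathbb E^w_{\pi\in G}f(\pi):=\frac{\sum_{\pi\in G}w(\pi)f(\pi)}{\sum_{\pi\in G}w(\pi)}$. For $M,N\colon G\to\mathbb C$ define $\Psi_M:=\mathbb E^w_{\pi\in G}L(\pi)M(\pi)$, $\Psi_{M,N}:=\mathbb E^w_{\pi\in G}L(\pi)M(\pi)\overline{L(\pi)N(\pi)}$, and $\beta(M):=|\Psi_M|^2/\Psi_{M,M}$ if $\Psi_{M,M}\ne0$, $\beta(M):=0$ if $\Psi_{M,M}=0$. It is assumed that the series $\sum_\pi w(\pi)$ and $\sum_\pi w(\pi)|L(\pi)M(\pi)|^2$ converge for every function $M$ considered (automatic if $G$ is finite). -}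

module Defs where

open import Algebra.Structures using (IsCommutativeRing)
open import Axiom.ExcludedMiddle using (ExcludedMiddle)
open import Data.List.Base using (List; []; _∷_)
open import Data.List.Relation.Binary.Subset.Propositional using (_⊆_)
open import Data.List.Relation.Unary.Unique.Propositional using (Unique)
open import Data.Product.Base using (∃; _×_; _,_; proj₁)
open import Level using (Level; suc)
open import Relation.Binary.Core using (Rel)
open import Relation.Binary.Structures using (IsTotalOrder)
open import Relation.Nullary.Decidable.Core using (Dec; yes; no)
open import Relation.Nullary.Negation.Core using (¬_)

-- The real numbers, given by their usual axiomatisation as an ordered field
-- with the least upper bound property.  Equality is a setoid equality, since
-- real numbers cannot be built with propositional equality without quotients.
record Reals (ℓ : Level) : Set (suc ℓ) where
  infix  8 _⁻¹
  infix  8 -_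
  infixl 7 _*_
  infixl 6 _+_
  infix  4 _≈_ _≤_ _<_
  field
    Carrier : Set ℓ
    _≈_     : Rel Carrier ℓ
    _≤_     : Rel Carrier ℓ
    _+_     : Carrier → Carrier → Carrier
    _*_     : Carrier → Carrier → Carrier
    -_      : Carrier → Carrier
    0#      : Carrier
    1#      : Carrier
    -- Nothing is assumed about the value of 0# ⁻¹.
    _⁻¹     : Carrier → Carrier

    isCommutativeRing : IsCommutativeRing _≈_ _+_ _*_ -_ 0# 1#
    0≉1               : ¬ (0# ≈ 1#)
    *-inverseʳ        : ∀ x → ¬ (x ≈ 0#) → x * x ⁻¹ ≈ 1#

    isTotalOrder : IsTotalOrder _≈_ _≤_
    +-monoˡ-≤    : ∀ z {x y} → x ≤ y → x + z ≤ y + z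
    *-nonNeg     : ∀ {x y} → 0# ≤ x → 0# ≤ y → 0# ≤ x * y

    supremum : (P : Carrier → Set ℓ) → ∃ P →
               (∃ λ b → ∀ x → P x → x ≤ b) →
               ∃ λ s → (∀ x → P x → x ≤ s) ×
                       (∀ b → (∀ x → P x → x ≤ b) → s ≤ b)

  _<_ : Rel Carrier ℓ
  x < y = x ≤ y × ¬ (x ≈ y)

module Complex {ℓ : Level} (ℝ : Reals ℓ) where
  open Reals ℝ

  infixl 7 _*ᶜ_ _/ᶜ_
  infixl 6 _+ᶜ_ _-ᶜ_
  infix  4 _≈ᶜ_

  record ℂ : Set ℓ where
    constructor _+i_
    field
      re : Carrier
      im : Carrier
  open ℂ public

  _≈ᶜ_ : Rel ℂ ℓ
  z ≈ᶜ u = re z ≈ re u × im z ≈ im u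

  fromℝ : Carrier → ℂ
  fromℝ x = x +i 0#

  0ᶜ : ℂ
  0ᶜ = fromℝ 0#

  _+ᶜ_ _-ᶜ_ _*ᶜ_ _/ᶜ_ : ℂ → ℂ → ℂ

  conj : ℂ → ℂ
  conj z = re z +i (- im z)

  ∣_∣² : ℂ → Carrier
  ∣ z ∣² = re z * re z + im z * im z

  z +ᶜ u = (re z + re u) +i (im z + im u)
  z -ᶜ u = (re z + (- re u)) +i (im z + (- im u))
  z *ᶜ u = (re z * re u + (- (im z * im u))) +i (re z * im u + im z * re u)
  -- Meaningful for u ≠ 0 only.
  z /ᶜ u = z *ᶜ conj u *ᶜ fromℝ (∣ u ∣² ⁻¹)

  module _ {G : Set ℓ} where

    finiteSum : (G → ℂ) → List G → ℂ
    finiteSum f []      = 0ᶜ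
    finiteSum f (π ∷ F) = f π +ᶜ finiteSum f F

    -- Convergence of the sum over the set G along the net of its finite
    -- subsets, represented by duplicate-free lists (the list F₀ only serves as
    -- a lower bound for inclusion, so it may have repetitions).  The last
    -- inequality is |finiteSum f F - s| < ε, squared.
    HasSum : (G → ℂ) → ℂ → Set ℓ
    HasSum f s = ∀ ε → 0# < ε →
      ∃ λ (F₀ : List G) → ∀ (F : List G) → Unique F → F₀ ⊆ F →
        ∣ finiteSum f F -ᶜ s ∣² < ε * ε

    Summable : (G → ℂ) → Set ℓ
    Summable f = ∃ λ s → HasSum f s

    -- The sum of a convergent series.  Excluded middle makes it a total
    -- function; the value 0 for divergent series is a dummy.
    sumOf : (f : G → ℂ) → Dec (Summable f) → ℂ
    sumOf f (yes c) = proj₁ c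
    sumOf f (no _)  = 0ᶜ

    ∑ : ExcludedMiddle ℓ → (G → ℂ) → ℂ
    ∑ em f = sumOf f em

module Weighted {ℓ : Level} (em : ExcludedMiddle ℓ) (ℝ : Reals ℓ) {G : Set ℓ}
  (L : G → Complex.ℂ ℝ) (w : G → Reals.Carrier ℝ) where
  open Reals ℝ
  open Complex ℝ

  𝔼 : (G → ℂ) → ℂ
  𝔼 f = ∑ em (λ π → fromℝ (w π) *ᶜ f π) /ᶜ ∑ em (λ π → fromℝ (w π))

  Ψ : (G → ℂ) → ℂ
  Ψ M = 𝔼 (λ π → L π *ᶜ M π)

  Ψ₂ : (G → ℂ) → (G → ℂ) → ℂ
  Ψ₂ M N = 𝔼 (λ π → L π *ᶜ M π *ᶜ conj (L π *ᶜ N π))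

  -- Ψ₂ M M is a weighted mean of the numbers |L π M π|², hence real, so that
  -- dividing by it is dividing by its real part.
  β : (G → ℂ) → Carrier
  β M with em {P = Ψ₂ M M ≈ᶜ 0ᶜ}
  ... | yes _ = 0#
  ... | no  _ = ∣ Ψ M ∣² * re (Ψ₂ M M) ⁻¹

{-# OPTIONS --safe #-}

-- The weighted mean is linear, so for K = M + αN the numbers Ψ_K and Ψ_{K,K} are polynomials
-- in α with coefficients a = Ψ_M, b = Ψ_N, c = Ψ_{M,N}, A = Ψ_{M,M}, B = Ψ_{N,N}.  The identity
-- β(K) Ψ_{K,K} = |Ψ_K|² holds for every K, since Ψ_{K,K} = 0 forces Ψ_K = 0.  Maximality of
-- β = β(M) therefore gives |a + αb|² ≤ β (A + 2 Re (conj α c) + |α|² B) with equality at α = 0, so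
-- the linear terms in α agree: conj a b = β conj c.  Multiplying by a and using |a|² = β A yields
-- a conj c = b A when β ≠ 0; when β = 0, both a and b vanish.
--
-- All series involved converge because w |z conj u| ≤ w (|z|² + |u|²), with u = 1 in the case
-- of Ψ, and absolutely convergent real series converge by completeness.

module Submission where

open import Defs
open import Axiom.ExcludedMiddle using (ExcludedMiddle)
open import Level using (Level)
open import Relation.Nullary.Negation.Core using (¬_)

open import Algebra.Bundles using (CommutativeRing)
import Algebra.Properties.Ring as RingProperties
import Algebra.Properties.Semiring.Mult.TCOptimised as Multiples
import Algebra.Properties.Monoid.Mult.TCOptimised as MonoidMultiples
import Algebra.Solver.Ring as RingSolver
open import Algebra.Solver.Ring.AlmostCommutativeRing
  using (fromCommutativeRing; _-Raw-AlmostCommutative⟶_)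
open import Data.Integer.Base as ℤ using (ℤ; -[1+_]; _⊖_; _◃_)
import Data.Integer.Properties as ℤ
open import Data.List.Base using (List; []; _∷_; _++_; deduplicate)
open import Data.List.Membership.Propositional.Properties
  using (∈-∃++; ∈-deduplicate⁺)
open import Data.List.Relation.Binary.Permutation.Propositional.Properties
  using (∈-resp-↭; shift)
open import Data.List.Relation.Binary.Subset.Propositional using (_⊆_)
open import Data.List.Relation.Binary.Subset.Propositional.Properties
  using (xs⊆xs++ys; xs⊆ys++xs; ⊆-trans)
open import Data.List.Relation.Unary.All as All using ()
open import Data.List.Relation.Unary.AllPairs using ([]; _∷_)
open import Data.List.Relation.Unary.Any using (here; there)
open import Data.List.Relation.Unary.Unique.Propositional using (Unique)
import Data.List.Relation.Unary.Unique.DecPropositional.Properties as DecUnique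
open import Data.Maybe.Base using (Maybe; just; nothing)
open import Data.Nat.Base as ℕ using (ℕ; zero; suc)
open import Data.Product.Base using (∃; _×_; _,_; proj₁; proj₂)
open import Data.Sign.Base as Sign using ()
open import Data.Sum.Base using (inj₁; inj₂)
open import Relation.Binary.PropositionalEquality.Core as ≡ using (_≡_)
open import Relation.Nullary.Decidable.Core using (Dec; yes; no)
open import Relation.Nullary.Negation.Core using (contradiction)
import Relation.Binary.Reasoning.Setoid as SetoidReasoning
open import Relation.Binary.Structures using (IsTotalOrder)

-- A ring solver with integer coefficients

module IntegerCoefficients {c ℓ : Level} (R : CommutativeRing c ℓ) where
  open CommutativeRing R
  open RingProperties ring
    using (-‿distribˡ-*; -‿distribʳ-*; -0#≈0#; -‿involutive; -‿+-comm)
  open Multiples semiring using (×1-homo-*) renaming (_×_ to _·_)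
  open MonoidMultiples +-monoid using (1+×; ×-homo-+)
  open SetoidReasoning setoid

  -- Polynomial normalisation has to compare coefficients. Equality in the ring does not compute,
  -- whereas equality of integers does, so coefficients are taken in ℤ and mapped into the ring.
  fromℤ : ℤ → Carrier
  fromℤ (ℤ.+ n)  = n · 1#
  fromℤ -[1+ n ] = - (suc n · 1#)

  -- Induction strips one unit from each argument. To restore it in the ring, `1# - 1#` is inserted
  -- and its two halves are moved to the two multiples.
  fromℤ-⊖ : ∀ m n → fromℤ (m ⊖ n) ≈ m · 1# - n · 1#
  fromℤ-⊖ zero    zero    = sym (-‿inverseʳ 0#)
  fromℤ-⊖ zero    (suc n) = sym (+-identityˡ _)
  fromℤ-⊖ (suc m) zero    = sym (trans (+-congˡ -0#≈0#) (+-identityʳ _))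
  fromℤ-⊖ (suc m) (suc n) = begin
    fromℤ (suc m ⊖ suc n)                      ≡⟨ ≡.cong fromℤ (ℤ.[1+m]⊖[1+n]≡m⊖n m n) ⟩
    fromℤ (m ⊖ n)                              ≈⟨ fromℤ-⊖ m n ⟩
    m · 1# - n · 1#                            ≈⟨ +-congʳ (+-identityʳ _) ⟨
    m · 1# + 0# - n · 1#                       ≈⟨ +-congʳ (+-congˡ (-‿inverseʳ 1#)) ⟨
    m · 1# + (1# - 1#) - n · 1#                ≈⟨ +-congʳ (+-assoc _ _ _) ⟨
    m · 1# + 1# - 1# - n · 1#                  ≈⟨ +-assoc _ _ _ ⟩
    m · 1# + 1# + (- 1# - n · 1#)              ≈⟨ +-cong (+-comm _ _) (-‿+-comm _ _) ⟩
    1# + m · 1# - (1# + n · 1#)                ≈⟨ +-cong (1+× m 1#) (-‿cong (1+× n 1#)) ⟨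
    suc m · 1# - suc n · 1#                    ∎

  fromℤ-+ : ∀ i j → fromℤ (i ℤ.+ j) ≈ fromℤ i + fromℤ j
  fromℤ-+ (ℤ.+ m)  (ℤ.+ n)  = ×-homo-+ 1# m n
  fromℤ-+ (ℤ.+ m)  -[1+ n ] = fromℤ-⊖ m (suc n)
  fromℤ-+ -[1+ m ] (ℤ.+ n)  = trans (fromℤ-⊖ n (suc m)) (+-comm _ _)
  fromℤ-+ -[1+ m ] -[1+ n ] = begin
    - (suc (suc (m ℕ.+ n)) · 1#)      ≈⟨ -‿cong (1+× (suc m ℕ.+ n) 1#) ⟩
    - (1# + (suc m ℕ.+ n) · 1#)       ≈⟨ -‿cong (+-congˡ (×-homo-+ 1# (suc m) n)) ⟩
    - (1# + (suc m · 1# + n · 1#))    ≈⟨ -‿cong (+-assoc _ _ _) ⟨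
    - (1# + suc m · 1# + n · 1#)      ≈⟨ -‿cong (+-congʳ (+-comm _ _)) ⟩
    - (suc m · 1# + 1# + n · 1#)      ≈⟨ -‿cong (+-assoc _ _ _) ⟩
    - (suc m · 1# + (1# + n · 1#))    ≈⟨ -‿cong (+-congˡ (1+× n 1#)) ⟨
    - (suc m · 1# + suc n · 1#)       ≈⟨ -‿+-comm _ _ ⟨
    - (suc m · 1#) - suc n · 1#       ∎

  fromℤ-neg : ∀ i → fromℤ (ℤ.- i) ≈ - fromℤ i
  fromℤ-neg (ℤ.+ zero)  = sym -0#≈0#
  fromℤ-neg (ℤ.+ suc n) = refl
  fromℤ-neg -[1+ n ]    = sym (-‿involutive _)

  fromℤ-* : ∀ i j → fromℤ (i ℤ.* j) ≈ fromℤ i * fromℤ j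
  fromℤ-* (ℤ.+ m) (ℤ.+ n) = begin
    fromℤ (Sign.+ ◃ m ℕ.* n)  ≡⟨ ≡.cong fromℤ (ℤ.+◃n≡+n (m ℕ.* n)) ⟩
    (m ℕ.* n) · 1#            ≈⟨ ×1-homo-* m n ⟩
    m · 1# * n · 1#           ∎
  fromℤ-* (ℤ.+ m) -[1+ n ] = begin
    fromℤ (Sign.- ◃ m ℕ.* suc n)  ≡⟨ ≡.cong fromℤ (ℤ.-◃n≡-n (m ℕ.* suc n)) ⟩
    fromℤ (ℤ.- ℤ.+ (m ℕ.* suc n)) ≈⟨ fromℤ-neg (ℤ.+ (m ℕ.* suc n)) ⟩
    - ((m ℕ.* suc n) · 1#)        ≈⟨ -‿cong (×1-homo-* m (suc n)) ⟩
    - (m · 1# * suc n · 1#)       ≈⟨ -‿distribʳ-* _ _ ⟩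
    m · 1# * - (suc n · 1#)       ∎
  fromℤ-* -[1+ m ] (ℤ.+ n) = begin
    fromℤ (Sign.- ◃ suc m ℕ.* n)  ≡⟨ ≡.cong fromℤ (ℤ.-◃n≡-n (suc m ℕ.* n)) ⟩
    fromℤ (ℤ.- ℤ.+ (suc m ℕ.* n)) ≈⟨ fromℤ-neg (ℤ.+ (suc m ℕ.* n)) ⟩
    - ((suc m ℕ.* n) · 1#)        ≈⟨ -‿cong (×1-homo-* (suc m) n) ⟩
    - (suc m · 1# * n · 1#)       ≈⟨ -‿distribˡ-* _ _ ⟩
    - (suc m · 1#) * n · 1#       ∎
  fromℤ-* -[1+ m ] -[1+ n ] = begin
    (suc m ℕ.* suc n) · 1#            ≈⟨ ×1-homo-* (suc m) (suc n) ⟩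
    suc m · 1# * suc n · 1#           ≈⟨ -‿involutive _ ⟨
    - - (suc m · 1# * suc n · 1#)     ≈⟨ -‿cong (-‿distribˡ-* _ _) ⟩
    - (- (suc m · 1#) * suc n · 1#)   ≈⟨ -‿distribʳ-* _ _ ⟩
    - (suc m · 1#) * - (suc n · 1#)   ∎

  -- With the optimised multiples `1 · 1#` computes to `1#`, so `con ℤ.0ℤ` and `con ℤ.1ℤ` in solver
  -- expressions denote exactly `0#` and `1#`.
  homomorphism : ℤ.+-*-rawRing -Raw-AlmostCommutative⟶ fromCommutativeRing R
  homomorphism = record
    { ⟦_⟧    = fromℤ
    ; +-homo = fromℤ-+
    ; *-homo = fromℤ-*
    ; -‿homo = fromℤ-neg
    ; 0-homo = refl
    ; 1-homo = refl
    }

  coefficient≟ : ∀ i j → Maybe (fromℤ i ≈ fromℤ j)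
  coefficient≟ i j with i ℤ.≟ j
  ... | yes i≡j = just (reflexive (≡.cong fromℤ i≡j))
  ... | no  _   = nothing

  open RingSolver ℤ.+-*-rawRing (fromCommutativeRing R) homomorphism coefficient≟ public
    using (solve; con; _:+_; _:*_; _:-_; :-_; _:=_)

-- Order and arithmetic of the reals

module OrderedField {ℓ : Level} (em : ExcludedMiddle ℓ) (ℝ : Reals ℓ) where
  open Reals ℝ public

  commutativeRing : CommutativeRing ℓ ℓ
  commutativeRing = record { isCommutativeRing = isCommutativeRing }

  open CommutativeRing commutativeRing public
    using ( refl; reflexive; sym; trans; +-cong; +-congˡ; +-congʳ; *-cong; *-congˡ; *-congʳ
          ; -‿cong; +-comm; *-comm; +-identityˡ; +-identityʳ; *-identityˡ; *-identityʳ
          ; zeroˡ; zeroʳ; distribˡ; +-assoc )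
  open IntegerCoefficients commutativeRing public
    using (solve; con; _:+_; _:*_; _:-_; :-_; _:=_)
  open IsTotalOrder isTotalOrder public
    using (total; antisym; ≤-respˡ-≈; ≤-respʳ-≈)
    renaming (refl to ≤-refl; reflexive to ≤-reflexive; trans to ≤-trans)

  -- The standard way to an inequality below: exhibit a nonnegative difference `d` and leave the
  -- identity to the ring solver. The differences are built from known inequalities by `gap`.
  by-nonNeg : ∀ {x y d} → 0# ≤ d → d + x ≈ y → x ≤ y
  by-nonNeg {x} 0≤d d+x≈y =
    ≤-respˡ-≈ (+-identityˡ x) (≤-respʳ-≈ d+x≈y (+-monoˡ-≤ x 0≤d))

  gap : ∀ {x y} → x ≤ y → 0# ≤ y + - x
  gap {x} x≤y = ≤-respˡ-≈ (solve 1 (λ x → x :- x := con ℤ.0ℤ) refl x) (+-monoˡ-≤ (- x) x≤y)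

  +-nonNeg : ∀ {x y} → 0# ≤ x → 0# ≤ y → 0# ≤ x + y
  +-nonNeg {x} {y} 0≤x 0≤y =
    ≤-trans 0≤y (by-nonNeg 0≤x refl)

  +-mono-≤ : ∀ {x y u v} → x ≤ y → u ≤ v → x + u ≤ y + v
  +-mono-≤ {x} {y} {u} {v} x≤y u≤v = by-nonNeg (+-nonNeg (gap x≤y) (gap u≤v))
    (solve 4 (λ x y u v → (y :- x) :+ (v :- u) :+ (x :+ u) := y :+ v) refl x y u v)

  *-monoˡ-≤ : ∀ {c x y} → 0# ≤ c → x ≤ y → c * x ≤ c * y
  *-monoˡ-≤ {c} {x} {y} 0≤c x≤y = by-nonNeg (*-nonNeg 0≤c (gap x≤y))
    (solve 3 (λ c x y → c :* (y :- x) :+ c :* x := c :* y) refl c x y)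

  neg-nonNeg : ∀ {x} → x ≤ 0# → 0# ≤ - x
  neg-nonNeg {x} x≤0 = ≤-respʳ-≈ (+-identityˡ (- x)) (gap x≤0)

  square-nonNeg : ∀ x → 0# ≤ x * x
  square-nonNeg x with total 0# x
  ... | inj₁ 0≤x = *-nonNeg 0≤x 0≤x
  ... | inj₂ x≤0 = ≤-respʳ-≈ (solve 1 (λ x → (:- x) :* (:- x) := x :* x) refl x)
                     (*-nonNeg (neg-nonNeg x≤0) (neg-nonNeg x≤0))

  0≤1 : 0# ≤ 1#
  0≤1 = ≤-respʳ-≈ (*-identityˡ 1#) (square-nonNeg 1#)

  *-cancelˡ : ∀ {x y z} → ¬ (x ≈ 0#) → x * y ≈ x * z → y ≈ z
  *-cancelˡ {x} {y} {z} x≉0 xy≈xz = trans (sym (shrink y)) (trans (*-congʳ xy≈xz) (shrink z))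
    where
    shrink : ∀ y → x * y * x ⁻¹ ≈ y
    shrink y = trans (solve 3 (λ x y r → x :* y :* r := x :* r :* y) refl x y (x ⁻¹))
                     (trans (*-congʳ (*-inverseʳ x x≉0)) (*-identityˡ y))

  *-zero-cancelˡ : ∀ {x y} → ¬ (x ≈ 0#) → x * y ≈ 0# → y ≈ 0#
  *-zero-cancelˡ {x} x≉0 xy≈0 = *-cancelˡ x≉0 (trans xy≈0 (sym (zeroʳ x)))

  pos≉0 : ∀ {x} → 0# < x → ¬ (x ≈ 0#)
  pos≉0 (_ , 0≉x) x≈0 = 0≉x (sym x≈0)

  pos≰0 : ∀ {x} → 0# < x → ¬ (x ≤ 0#)
  pos≰0 (0≤x , 0≉x) x≤0 = 0≉x (antisym 0≤x x≤0)

  *-pos : ∀ {x y} → 0# < x → 0# < y → 0# < x * y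
  *-pos 0<x 0<y = *-nonNeg (proj₁ 0<x) (proj₁ 0<y) ,
    λ 0≈xy → pos≉0 0<y (*-zero-cancelˡ (pos≉0 0<x) (sym 0≈xy))

  -- If `y` is not positive, neither is `x * y`, so the product is zero and `y` with it.
  *-nonNeg-cancelˡ : ∀ {x y} → 0# < x → 0# ≤ x * y → 0# ≤ y
  *-nonNeg-cancelˡ {x} {y} 0<x 0≤xy with total 0# y
  ... | inj₁ 0≤y = 0≤y
  ... | inj₂ y≤0 = ≤-reflexive (sym (*-zero-cancelˡ (pos≉0 0<x) (antisym xy≤0 0≤xy)))
    where
    xy≤0 : x * y ≤ 0#
    xy≤0 = ≤-respʳ-≈ (zeroʳ x) (*-monoˡ-≤ (proj₁ 0<x) y≤0)

  +-pos : ∀ {x y} → 0# ≤ x → 0# < y → 0# < x + y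
  +-pos 0≤x 0<y = +-nonNeg 0≤x (proj₁ 0<y) ,
    λ 0≈x+y → pos≰0 0<y (by-nonNeg 0≤x (sym 0≈x+y))

  ⁻¹-pos : ∀ {x} → 0# < x → 0# < x ⁻¹
  ⁻¹-pos {x} 0<x =
    *-nonNeg-cancelˡ 0<x (≤-respʳ-≈ (sym xx⁻¹≈1) 0≤1) ,
    λ 0≈x⁻¹ → 0≉1 (trans (sym (trans (*-congˡ (sym 0≈x⁻¹)) (zeroʳ x))) xx⁻¹≈1)
    where
    xx⁻¹≈1 : x * x ⁻¹ ≈ 1#
    xx⁻¹≈1 = *-inverseʳ x (pos≉0 0<x)

  -- The choice is δ = ε / (c + 1). The extra 1 keeps the denominator positive when c = 0. Besides
  -- splitting ε for limits, this supplies the test point of `linear≤quadratic⇒zero`.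
  divide : ∀ {c ε} → 0# ≤ c → 0# < ε → ∃ λ δ → 0# < δ × c * δ + δ ≈ ε
  divide {c} {ε} 0≤c 0<ε =
    (c + 1#) ⁻¹ * ε , *-pos (⁻¹-pos 0<c+1) 0<ε ,
    trans (solve 3 (λ c r ε → c :* (r :* ε) :+ r :* ε := (c :+ con ℤ.1ℤ) :* r :* ε) refl c _ ε)
          (trans (*-congʳ (*-inverseʳ (c + 1#) (pos≉0 0<c+1))) (*-identityˡ ε))
    where
    0<c+1 : 0# < c + 1#
    0<c+1 = +-pos 0≤c (0≤1 , 0≉1)

  halve : ∀ {ε} → 0# < ε → ∃ λ δ → 0# < δ × δ + δ ≈ ε
  halve 0<ε =
    let δ , 0<δ , δ+δ≈ε = divide 0≤1 0<ε
    in δ , 0<δ , trans (+-congʳ (sym (*-identityˡ δ))) δ+δ≈ε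

  -- If `y` lay strictly below `x`, taking half of the difference x - y as ε would make that half at
  -- most 0.
  ≤-limit : ∀ {x y} → (∀ ε → 0# < ε → x ≤ y + ε) → x ≤ y
  ≤-limit {x} {y} x≤y+ with total x y | em {P = x ≈ y}
  ... | inj₁ x≤y | _       = x≤y
  ... | inj₂ y≤x | yes x≈y = ≤-reflexive x≈y
  ... | inj₂ y≤x | no  x≉y =
    let δ , 0<δ , δ+δ≈x-y = halve (gap y≤x , λ 0≈x-y → x≉y
          (trans (solve 2 (λ x y → x := x :- y :+ y) refl x y)
                 (trans (+-congʳ (sym 0≈x-y)) (+-identityˡ y))))
    in contradiction
      (by-nonNeg (gap (x≤y+ δ 0<δ))
        (trans (solve 3 (λ x y δ → y :+ δ :- x :+ δ := δ :+ δ :- (x :- y)) refl x y δ)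
        (trans (+-congʳ δ+δ≈x-y)
               (solve 2 (λ x y → x :- y :- (x :- y) := con ℤ.0ℤ) refl x y))))
      (pos≰0 0<δ)

  +-nonNeg-halve : ∀ {x} → 0# ≤ x + x → 0# ≤ x
  +-nonNeg-halve {x} 0≤x+x with total 0# x
  ... | inj₁ 0≤x = 0≤x
  ... | inj₂ x≤0 = ≤-trans 0≤x+x (≤-respʳ-≈ (+-identityˡ x) (+-monoˡ-≤ x x≤0))

  -- Twice the form equals x² + y² + (x + y)².
  quadratic-nonNeg : ∀ x y → 0# ≤ x * x + y * y + x * y
  quadratic-nonNeg x y = +-nonNeg-halve (≤-respʳ-≈
    (solve 2 (λ x y → (x :* x :+ y :* y) :+ (x :+ y) :* (x :+ y)
                   := (x :* x :+ y :* y :+ x :* y) :+ (x :* x :+ y :* y :+ x :* y)) refl x y)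
    (+-nonNeg (+-nonNeg (square-nonNeg x) (square-nonNeg y)) (square-nonNeg (x + y))))

  -- In the case e ≤ x, the product (x + e)(e - x) = e² - x² is nonnegative and its first factor is
  -- positive, so the second is nonnegative.
  square-≤⇒≤ : ∀ {x e} → 0# < e → x * x ≤ e * e → x ≤ e
  square-≤⇒≤ {x} {e} 0<e x²≤e² with total x e
  ... | inj₁ x≤e = x≤e
  ... | inj₂ e≤x = by-nonNeg
      (*-nonNeg-cancelˡ (+-pos (≤-trans (proj₁ 0<e) e≤x) 0<e)
        (≤-respʳ-≈ (solve 2 (λ x e → e :* e :- x :* x := (x :+ e) :* (e :- x)) refl x e)
          (gap x²≤e²)))
      (solve 2 (λ x e → e :- x :+ x := e) refl x e)

  ≤⇒square-≤ : ∀ {x e} → x ≤ e → - x ≤ e → x * x ≤ e * e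
  ≤⇒square-≤ {x} {e} x≤e -x≤e = by-nonNeg (*-nonNeg (gap x≤e) (gap -x≤e))
    (solve 2 (λ x e → (e :- x) :* (e :- :- x) :+ x :* x := e :* e) refl x e)

  square-zero : ∀ {x} → x * x ≈ 0# → x ≈ 0#
  square-zero {x} x²≈0 with em {P = x ≈ 0#}
  ... | yes x≈0 = x≈0
  ... | no  x≉0 = *-zero-cancelˡ x≉0 x²≈0

  sum-of-squares-zero : ∀ {x y} → x * x + y * y ≤ 0# → x ≈ 0# × y ≈ 0#
  sum-of-squares-zero {x} {y} x²+y²≤0 =
    square-zero (antisym (≤-trans (by-nonNeg (square-nonNeg y) (+-comm _ _)) x²+y²≤0)
                         (square-nonNeg x)) ,
    square-zero (antisym (≤-trans (by-nonNeg (square-nonNeg x) refl) x²+y²≤0)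
                         (square-nonNeg y))

  -- Take t = 1 / (q + 1), so that q t = 1 - t. The hypothesis becomes 2tD ≤ tD (1 - t), whence tD ≤
  -- -t²D ≤ 0, while t > 0 and D ≥ 0.
  linear≤quadratic⇒zero : ∀ {D q} → 0# ≤ D → 0# ≤ q →
    (∀ t → t * D + t * D ≤ t * t * D * q) → D ≈ 0#
  linear≤quadratic⇒zero {D} {q} 0≤D 0≤q bound =
    let t , 0<t , qt+t≈1 = divide 0≤q (0≤1 , 0≉1)
        0≤tD = *-nonNeg (proj₁ 0<t) 0≤D
        tD≤0 = by-nonNeg (+-nonNeg (gap (bound t)) (*-nonNeg (proj₁ 0<t) 0≤tD)) (trans
          (solve 3 (λ t D q → t :* t :* D :* q :- (t :* D :+ t :* D) :+ t :* (t :* D) :+ t :* D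
                           := t :* D :* (q :* t :+ t :- con ℤ.1ℤ)) refl t D q)
          (trans (*-congˡ (+-congʳ qt+t≈1))
                 (solve 1 (λ x → x :* (con ℤ.1ℤ :- con ℤ.1ℤ) := con ℤ.0ℤ) refl (t * D))))
    in *-zero-cancelˡ (pos≉0 0<t) (antisym tD≤0 0≤tD)

-- Limits along the net of finite subsets

module Nets {ℓ : Level} (em : ExcludedMiddle ℓ) (ℝ : Reals ℓ) {G : Set ℓ} where
  open OrderedField em ℝ

  -- This is the quantifier pattern inside `HasSum`, so a `HasSum` proof applied to some ε is
  -- already of this form.
  Eventually : (List G → Set ℓ) → Set ℓ
  Eventually P = ∃ λ F₀ → ∀ F → Unique F → F₀ ⊆ F → P F

  eventually-map₂ : {P Q R : List G → Set ℓ} → (∀ F → P F → Q F → R F) →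
    Eventually P → Eventually Q → Eventually R
  eventually-map₂ f (F₁ , p) (F₂ , q) = F₁ ++ F₂ , λ F F! F₁₂⊆F →
    f F (p F F! (⊆-trans (xs⊆xs++ys F₁ F₂) F₁₂⊆F)) (q F F! (⊆-trans (xs⊆ys++xs F₂ F₁) F₁₂⊆F))

  eventually-map : {P Q : List G → Set ℓ} → (∀ F → P F → Q F) → Eventually P → Eventually Q
  eventually-map f (F₀ , p) = F₀ , λ F F! F₀⊆F → f F (p F F! F₀⊆F)

  always : {P : List G → Set ℓ} → (∀ F → P F) → Eventually P
  always p = [] , λ F _ _ → p F

  -- The threshold `F₀` may have repetitions, but the property is promised only for duplicate-free
  -- lists. Removing repetitions takes decidable equality on `G`, which excluded middle provides.
  eventually-witness : {P : List G → Set ℓ} → Eventually P → ∃ P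
  eventually-witness (F₀ , p) =
    deduplicate _≟_ F₀ , p _ (DecUnique.deduplicate-! _≟_ F₀) (∈-deduplicate⁺ _≟_)
    where
    _≟_ : (x y : G) → Dec (x ≡ y)
    x ≟ y = em

  -- The condition |φ F - s| ≤ ε, split into two linear inequalities that can be added and scaled
  -- without absolute values.
  Tends : (List G → Carrier) → Carrier → Set ℓ
  Tends φ s = ∀ ε → 0# < ε → Eventually λ F → φ F ≤ s + ε × s ≤ φ F + ε

  -- At one list where all three conditions hold, s ≤ φ F + δ ≤ ψ F + δ ≤ t + 2δ, and ε = 2δ is
  -- arbitrary.
  tends-mono : ∀ {φ ψ s t} → Eventually (λ F → φ F ≤ ψ F) → Tends φ s → Tends ψ t → s ≤ t
  tends-mono {φ} {ψ} {s} {t} φ≤ψ φ→s ψ→t = ≤-limit λ ε 0<ε →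
    let δ , 0<δ , δ+δ≈ε = halve 0<ε
        F , (_ , s≤φ) , (ψ≤t , _) , φF≤ψF = eventually-witness
          (eventually-map₂ (λ _ p q → proj₁ p , proj₂ p , q)
            (eventually-map₂ (λ _ → _,_) (φ→s δ 0<δ) (ψ→t δ 0<δ)) φ≤ψ)
    in ≤-trans s≤φ (≤-trans (+-monoˡ-≤ δ (≤-trans φF≤ψF ψ≤t))
         (≤-reflexive (trans (+-assoc t δ δ) (+-congˡ δ+δ≈ε))))

  tends-cong : ∀ {φ ψ s t} → (∀ F → φ F ≈ ψ F) → s ≈ t → Tends φ s → Tends ψ t
  tends-cong φ≈ψ s≈t φ→s ε 0<ε = eventually-map
    (λ F (φ≤s , s≤φ) → ≤-respˡ-≈ (φ≈ψ F) (≤-respʳ-≈ (+-congʳ s≈t) φ≤s)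
                     , ≤-respˡ-≈ s≈t (≤-respʳ-≈ (+-congʳ (φ≈ψ F)) s≤φ))
    (φ→s ε 0<ε)

  tends-unique : ∀ {φ ψ s t} → (∀ F → φ F ≈ ψ F) → Tends φ s → Tends ψ t → s ≈ t
  tends-unique φ≈ψ φ→s ψ→t = antisym
    (tends-mono (always λ F → ≤-reflexive (φ≈ψ F)) φ→s ψ→t)
    (tends-mono (always λ F → ≤-reflexive (sym (φ≈ψ F))) ψ→t φ→s)

  tends-const : ∀ c → Tends (λ _ → c) c
  tends-const c ε (0≤ε , _) = always λ _ → c≤c+ε , c≤c+ε
    where
    c≤c+ε : c ≤ c + ε
    c≤c+ε = by-nonNeg 0≤ε (+-comm ε c)

  tends-+ : ∀ {φ ψ s t} → Tends φ s → Tends ψ t → Tends (λ F → φ F + ψ F) (s + t)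
  tends-+ φ→s ψ→t ε 0<ε =
    let δ , 0<δ , δ+δ≈ε = halve 0<ε
    in eventually-map₂
      (λ F (φ≤s , s≤φ) (ψ≤t , t≤ψ) → add δ+δ≈ε φ≤s ψ≤t , add δ+δ≈ε s≤φ t≤ψ)
      (φ→s δ 0<δ) (ψ→t δ 0<δ)
    where
    add : ∀ {δ x y u v} → δ + δ ≈ ε → x ≤ y + δ → u ≤ v + δ → x + u ≤ y + v + ε
    add {δ} {y = y} {v = v} δ+δ≈ε x≤y+δ u≤v+δ = ≤-respʳ-≈
      (trans (solve 3 (λ y v δ → (y :+ δ) :+ (v :+ δ) := y :+ v :+ (δ :+ δ)) refl y v δ)
             (+-congˡ δ+δ≈ε))
      (+-mono-≤ x≤y+δ u≤v+δ)

  tends-neg : ∀ {φ s} → Tends φ s → Tends (λ F → - φ F) (- s)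
  tends-neg φ→s ε 0<ε = eventually-map
    (λ F (φ≤s , s≤φ) → by-nonNeg (gap s≤φ) (reflect _ _) , by-nonNeg (gap φ≤s) (reflect _ _))
    (φ→s ε 0<ε)
    where
    reflect : ∀ x y → y + ε + - x + - y ≈ - x + ε
    reflect x y = solve 3 (λ x y ε → y :+ ε :+ :- x :+ :- y := :- x :+ ε) refl x y ε

  tends-*-nonNeg : ∀ {c φ s} → 0# ≤ c → Tends φ s → Tends (λ F → c * φ F) (c * s)
  tends-*-nonNeg {c} 0≤c φ→s ε 0<ε =
    let δ , 0<δ , cδ+δ≈ε = divide 0≤c 0<ε
    in eventually-map
      (λ F (φ≤s , s≤φ) → scale (proj₁ 0<δ) cδ+δ≈ε φ≤s , scale (proj₁ 0<δ) cδ+δ≈ε s≤φ)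
      (φ→s δ 0<δ)
    where
    scale : ∀ {δ x y} → 0# ≤ δ → c * δ + δ ≈ ε → x ≤ y + δ → c * x ≤ c * y + ε
    scale {δ} {x} {y} 0≤δ cδ+δ≈ε x≤y+δ = by-nonNeg (+-nonNeg (*-nonNeg 0≤c (gap x≤y+δ)) 0≤δ)
      (trans (solve 4 (λ c x y δ → c :* (y :+ δ :- x) :+ δ :+ c :* x
                                := c :* y :+ (c :* δ :+ δ)) refl c x y δ)
             (+-congˡ cδ+δ≈ε))

  tends-* : ∀ c {φ s} → Tends φ s → Tends (λ F → c * φ F) (c * s)
  tends-* c {φ} {s} φ→s with total 0# c
  ... | inj₁ 0≤c = tends-*-nonNeg 0≤c φ→s
  ... | inj₂ c≤0 = tends-cong (λ F → simplify (φ F)) (simplify s)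
                     (tends-neg (tends-*-nonNeg (neg-nonNeg c≤0) φ→s))
    where
    simplify : ∀ x → - (- c * x) ≈ c * x
    simplify x = solve 2 (λ c x → :- ((:- c) :* x) := c :* x) refl c x

  -- Finite and unordered sums of real functions

  Σ : (G → Carrier) → List G → Carrier
  Σ f []      = 0#
  Σ f (π ∷ F) = f π + Σ f F

  Σ-cong : ∀ {f g} → (∀ π → f π ≈ g π) → ∀ F → Σ f F ≈ Σ g F
  Σ-cong f≈g []      = refl
  Σ-cong f≈g (π ∷ F) = +-cong (f≈g π) (Σ-cong f≈g F)

  Σ-mono : ∀ {f g} → (∀ π → f π ≤ g π) → ∀ F → Σ f F ≤ Σ g F
  Σ-mono f≤g []      = ≤-refl
  Σ-mono f≤g (π ∷ F) = +-mono-≤ (f≤g π) (Σ-mono f≤g F)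

  Σ-+ : ∀ f g F → Σ f F + Σ g F ≈ Σ (λ π → f π + g π) F
  Σ-+ f g []      = +-identityˡ 0#
  Σ-+ f g (π ∷ F) = trans
    (solve 4 (λ a b c d → a :+ b :+ (c :+ d) := a :+ c :+ (b :+ d)) refl (f π) _ (g π) _)
    (+-congˡ (Σ-+ f g F))

  Σ-* : ∀ c f F → c * Σ f F ≈ Σ (λ π → c * f π) F
  Σ-* c f []      = zeroʳ c
  Σ-* c f (π ∷ F) = trans (distribˡ c _ _) (+-congˡ (Σ-* c f F))

  Σ-zero : ∀ {f} → (∀ π → f π ≈ 0#) → ∀ F → Σ f F ≈ 0#
  Σ-zero f≈0 []      = refl
  Σ-zero f≈0 (π ∷ F) = trans (+-cong (f≈0 π) (Σ-zero f≈0 F)) (+-identityˡ 0#)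

  Σ-nonNeg : ∀ {f} → (∀ π → 0# ≤ f π) → ∀ F → 0# ≤ Σ f F
  Σ-nonNeg 0≤f []      = ≤-refl
  Σ-nonNeg 0≤f (π ∷ F) = +-nonNeg (0≤f π) (Σ-nonNeg 0≤f F)

  Σ-shift : ∀ f π F₁ F₂ → f π + Σ f (F₁ ++ F₂) ≈ Σ f (F₁ ++ π ∷ F₂)
  Σ-shift f π []       F₂ = refl
  Σ-shift f π (ρ ∷ F₁) F₂ = trans
    (solve 3 (λ a b c → a :+ (b :+ c) := b :+ (a :+ c)) refl (f π) (f ρ) _)
    (+-congˡ (Σ-shift f π F₁ F₂))

  -- The head `π` of `F₀` is located in `F` and removed there. The tail of `F₀` does not contain `π`
  -- again, so it is still included in what remains and induction applies.
  Σ-⊆ : ∀ {f} → (∀ π → 0# ≤ f π) → ∀ {F₀ F} → Unique F₀ → F₀ ⊆ F → Σ f F₀ ≤ Σ f F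
  Σ-⊆ 0≤f {[]}     {F} []           _    = Σ-nonNeg 0≤f F
  Σ-⊆ {f} 0≤f {π ∷ F₀} (π∉F₀ ∷ F₀!) F₀⊆F with ∈-∃++ (F₀⊆F (here ≡.refl))
  ... | F₁ , F₂ , ≡.refl =
    ≤-trans (+-mono-≤ (≤-refl {f π}) (Σ-⊆ 0≤f F₀! F₀⊆F₁₂)) (≤-reflexive (Σ-shift f π F₁ F₂))
    where
    F₀⊆F₁₂ : F₀ ⊆ F₁ ++ F₂
    F₀⊆F₁₂ ρ∈F₀ with ∈-resp-↭ (shift π F₁ F₂) (F₀⊆F (there ρ∈F₀))
    ... | here ρ≡π    = contradiction (≡.sym ρ≡π) (All.lookup π∉F₀ ρ∈F₀)
    ... | there ρ∈F₁₂ = ρ∈F₁₂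

  Sums : (G → Carrier) → Carrier → Set ℓ
  Sums f s = Tends (Σ f) s

  sums-cong : ∀ {f g s t} → (∀ π → f π ≈ g π) → s ≈ t → Sums f s → Sums g t
  sums-cong f≈g = tends-cong (Σ-cong f≈g)

  sums-unique : ∀ {f g s t} → (∀ π → f π ≈ g π) → Sums f s → Sums g t → s ≈ t
  sums-unique f≈g = tends-unique (Σ-cong f≈g)

  sums-+ : ∀ {f g s t} → Sums f s → Sums g t → Sums (λ π → f π + g π) (s + t)
  sums-+ {f} {g} Σf Σg = tends-cong (Σ-+ f g) refl (tends-+ Σf Σg)

  sums-* : ∀ c {f s} → Sums f s → Sums (λ π → c * f π) (c * s)
  sums-* c {f} Σf = tends-cong (Σ-* c f) refl (tends-* c Σf)

  sums-zero : ∀ {f} → (∀ π → f π ≈ 0#) → Sums f 0#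
  sums-zero f≈0 = tends-cong (λ F → sym (Σ-zero f≈0 F)) refl (tends-const 0#)

  sums-nonNeg : ∀ {f s} → (∀ π → 0# ≤ f π) → Sums f s → 0# ≤ s
  sums-nonNeg 0≤f Σf = tends-mono (always (Σ-nonNeg 0≤f)) (tends-const 0#) Σf

  -- The finite sum over `F₀` is regarded as a constant net. It is dominated by the partial sums
  -- over all lists containing `F₀`, so the comparison passes to the limit.
  Σ≤sum : ∀ {f s} → (∀ π → 0# ≤ f π) → Sums f s → ∀ {F} → Unique F → Σ f F ≤ s
  Σ≤sum {f} 0≤f Σf {F₀} F₀! = tends-mono
    (F₀ , λ F _ F₀⊆F → Σ-⊆ 0≤f F₀! F₀⊆F) (tends-const (Σ f F₀)) Σf

  term≤sum : ∀ {f s} → (∀ π → 0# ≤ f π) → Sums f s → ∀ π → f π ≤ s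
  term≤sum {f} 0≤f Σf π = ≤-respˡ-≈ (+-identityʳ (f π)) (Σ≤sum 0≤f Σf (All.[] ∷ []))

  -- The sum is the supremum of the partial sums over duplicate-free lists: one of them comes within
  -- ε of the supremum, and by `Σ-⊆` every larger list does at least as well.
  bounded⇒sums : ∀ {f b} → (∀ π → 0# ≤ f π) → (∀ F → Unique F → Σ f F ≤ b) → ∃ (Sums f)
  bounded⇒sums {f} {b} 0≤f Σf≤b with supremum
    (λ x → ∃ λ F → Unique F × x ≈ Σ f F)
    (0# , [] , [] , refl)
    (b , λ { x (F , F! , x≈Σ) → ≤-respˡ-≈ (sym x≈Σ) (Σf≤b F F!) })
  ... | s , upper , least = s , converges
    where
    Σ≤s : ∀ {F} → Unique F → Σ f F ≤ s
    Σ≤s {F} F! = upper (Σ f F) (F , F! , refl)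

    converges : Sums f s
    converges ε 0<ε with em {P = ∃ λ F → Unique F × s ≤ Σ f F + ε}
    ... | yes (F₀ , F₀! , s≤ΣF₀+ε) = F₀ , λ F F! F₀⊆F →
      ≤-trans (Σ≤s F!) (by-nonNeg (proj₁ 0<ε) (+-comm ε s)) ,
      ≤-trans s≤ΣF₀+ε (+-monoˡ-≤ ε (Σ-⊆ 0≤f F₀! F₀⊆F))
    -- If no partial sum came within ε of `s`, then s - ε would be a smaller upper bound.
    ... | no ¬near = contradiction
      (by-nonNeg (gap (least (s + - ε) s-ε-upper))
        (solve 2 (λ s ε → s :- ε :- s :+ ε := con ℤ.0ℤ) refl s ε))
      (pos≰0 0<ε)
      where
      s-ε-upper : ∀ x → (∃ λ F → Unique F × x ≈ Σ f F) → x ≤ s + - ε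
      s-ε-upper x (F , F! , x≈Σ) with total s (Σ f F + ε)
      ... | inj₁ s≤Σ+ε = contradiction (F , F! , s≤Σ+ε) ¬near
      ... | inj₂ Σ+ε≤s = ≤-respˡ-≈ (sym x≈Σ) (by-nonNeg (gap Σ+ε≤s)
        (solve 3 (λ s ε x → s :- (x :+ ε) :+ x := s :- ε) refl s ε (Σ f F)))

  -- f is the difference of the nonnegative functions g + f ≤ g + g and g.
  dominated⇒sums : ∀ {f g t} → (∀ π → 0# ≤ g π + f π) → (∀ π → 0# ≤ g π + - f π) →
    Sums g t → ∃ (Sums f)
  dominated⇒sums {f} {g} 0≤g+f 0≤g-f Σg = _ , sums-cong
    (λ π → solve 2 (λ f g → g :+ f :+ (:- con ℤ.1ℤ) :* g := f) refl (f π) (g π)) refl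
    (sums-+ (proj₂ Σg+f) (sums-* (- 1#) Σg))
    where
    g+f≤g+g : ∀ π → g π + f π ≤ g π + g π
    g+f≤g+g π = by-nonNeg (0≤g-f π)
      (solve 2 (λ f g → g :- f :+ (g :+ f) := g :+ g) refl (f π) (g π))
    Σg+f : ∃ (Sums (λ π → g π + f π))
    Σg+f = bounded⇒sums 0≤g+f (λ F F! → ≤-trans (Σ-mono g+f≤g+g F)
      (Σ≤sum (λ π → ≤-trans (0≤g+f π) (g+f≤g+g π)) (sums-+ Σg Σg) F!))

-- Complex sums by real and imaginary parts

module ComplexSums {ℓ : Level} (em : ExcludedMiddle ℓ) (ℝ : Reals ℓ) {G : Set ℓ} where
  open OrderedField em ℝ
  open Complex ℝ
  open Nets em ℝ {G}

  re-finiteSum : ∀ f F → re (finiteSum f F) ≡ Σ (λ π → re (f π)) F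
  re-finiteSum f []      = ≡.refl
  re-finiteSum f (π ∷ F) = ≡.cong (re (f π) +_) (re-finiteSum f F)

  im-finiteSum : ∀ f F → im (finiteSum f F) ≡ Σ (λ π → im (f π)) F
  im-finiteSum f []      = ≡.refl
  im-finiteSum f (π ∷ F) = ≡.cong (im (f π) +_) (im-finiteSum f F)

  -- Here `r` stands for the square of the other component, which is dropped from the squared
  -- distance.
  square-≤⇒close : ∀ {x s ε r} → 0# < ε → 0# ≤ r →
    (x + - s) * (x + - s) + r ≤ ε * ε → x ≤ s + ε × s ≤ x + ε
  square-≤⇒close {x} {s} {ε} {r} 0<ε 0≤r bound =
    by-nonNeg (gap (square-≤⇒≤ 0<ε d²≤ε²))
      (solve 3 (λ x s ε → ε :- (x :- s) :+ x := s :+ ε) refl x s ε) ,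
    by-nonNeg (gap (square-≤⇒≤ 0<ε (≤-respˡ-≈ flip d²≤ε²)))
      (solve 3 (λ x s ε → ε :- (s :- x) :+ s := x :+ ε) refl x s ε)
    where
    d²≤ε² : (x + - s) * (x + - s) ≤ ε * ε
    d²≤ε² = ≤-trans (by-nonNeg 0≤r (+-comm _ _)) bound
    flip : (x + - s) * (x + - s) ≈ (s + - x) * (s + - x)
    flip = solve 2 (λ x s → (x :- s) :* (x :- s) := (s :- x) :* (s :- x)) refl x s

  hasSum⇒sums : ∀ {f s} → HasSum f s →
    Sums (λ π → re (f π)) (re s) × Sums (λ π → im (f π)) (im s)
  hasSum⇒sums {f} {s} f→s =
    tends-cong (λ F → reflexive (re-finiteSum f F)) refl (λ ε 0<ε → eventually-map
      (λ F (bound , _) → square-≤⇒close 0<ε (square-nonNeg _) bound) (f→s ε 0<ε)) ,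
    tends-cong (λ F → reflexive (im-finiteSum f F)) refl (λ ε 0<ε → eventually-map
      (λ F (bound , _) → square-≤⇒close 0<ε (square-nonNeg _)
        (≤-respˡ-≈ (+-comm _ _) bound)) (f→s ε 0<ε))

  close⇒square-≤ : ∀ {x s δ} → x ≤ s + δ → s ≤ x + δ → (x + - s) * (x + - s) ≤ δ * δ
  close⇒square-≤ {x} {s} {δ} x≤s+δ s≤x+δ = ≤⇒square-≤
    (by-nonNeg (gap x≤s+δ) (solve 3 (λ x s δ → s :+ δ :- x :+ (x :- s) := δ) refl x s δ))
    (by-nonNeg (gap s≤x+δ) (solve 3 (λ x s δ → x :+ δ :- s :+ :- (x :- s) := δ) refl x s δ))

  -- With both components within δ = ε / 2, the squared distance is at most 2δ². Since ε² = 4δ², a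
  -- margin of 2δ² > 0 is left, which makes the inequality strict.
  sums⇒hasSum : ∀ {f s} → Sums (λ π → re (f π)) (re s) → Sums (λ π → im (f π)) (im s) →
    HasSum f s
  sums⇒hasSum {f} {s} re→ im→ ε 0<ε =
    let δ , 0<δ , δ+δ≈ε = halve 0<ε
    in eventually-map₂
      (λ F (re≤ , ≤re) (im≤ , ≤im) → close 0<δ δ+δ≈ε
        (≤-respˡ-≈ (square-cong (re-finiteSum f F)) (close⇒square-≤ re≤ ≤re))
        (≤-respˡ-≈ (square-cong (im-finiteSum f F)) (close⇒square-≤ im≤ ≤im)))
      (re→ δ 0<δ) (im→ δ 0<δ)
    where
    square-cong : ∀ {x y t} → x ≡ y → (y + - t) * (y + - t) ≈ (x + - t) * (x + - t)
    square-cong ≡.refl = refl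

    close : ∀ {δ x y} → 0# < δ → δ + δ ≈ ε → x ≤ δ * δ → y ≤ δ * δ → x + y < ε * ε
    close {δ} {x} {y} 0<δ δ+δ≈ε x≤δ² y≤δ² =
      by-nonNeg (≤-trans (proj₁ 0<2δ²) 2δ²≤gap)
        (solve 2 (λ a e → e :- a :+ a := e) refl (x + y) (ε * ε)) ,
      λ x+y≈ε² → pos≰0 0<2δ² (≤-respʳ-≈ (trans (+-congʳ (sym x+y≈ε²))
        (solve 1 (λ a → a :- a := con ℤ.0ℤ) refl (x + y))) 2δ²≤gap)
      where
      0<2δ² : 0# < δ * δ + δ * δ
      0<2δ² = +-pos (square-nonNeg δ) (*-pos 0<δ 0<δ)
      2δ²≤gap : δ * δ + δ * δ ≤ ε * ε + - (x + y)
      2δ²≤gap = by-nonNeg (+-nonNeg (gap x≤δ²) (gap y≤δ²)) (trans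
        (solve 3 (λ x y δ → δ :* δ :- x :+ (δ :* δ :- y) :+ (δ :* δ :+ δ :* δ)
                         := (δ :+ δ) :* (δ :+ δ) :- (x :+ y)) refl x y δ)
        (+-congʳ (*-cong δ+δ≈ε δ+δ≈ε)))

  hasSum-∑ : {f : G → ℂ} → Summable f → HasSum f (∑ em f)
  hasSum-∑ {f} summable = hasSum-sumOf em
    where
    -- The decision is generalised away from `em`, so that `sumOf` reduces in each case; summability
    -- rules out the dummy value.
    hasSum-sumOf : (summable? : Dec (Summable f)) → HasSum f (sumOf f summable?)
    hasSum-sumOf (yes (_ , f→s)) = f→s
    hasSum-sumOf (no ¬summable)  = contradiction summable ¬summable

-- The variational argument for complex coefficients

module Optimality {ℓ : Level} (em : ExcludedMiddle ℓ) (ℝ : Reals ℓ) where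
  open OrderedField em ℝ
  open Complex ℝ

  -- With d = conj a b − β conj c, the hypothesis says 2 Re (α d) ≤ |α|² (β B − |b|²).
  -- Taking α = t conj d for all real t forces d = 0.
  module _ {a b c : ℂ} {A B β : Carrier}
    (βA≈∣a∣² : β * A ≈ ∣ a ∣²)
    (∣b∣²≤βB : ∣ b ∣² ≤ β * B)
    (bound : ∀ α → ∣ a +ᶜ α *ᶜ b ∣²
      ≤ β * (A + (re (conj α *ᶜ c) + re (conj α *ᶜ c)) + ∣ α ∣² * B))
    where

    private
      a₁ a₂ b₁ b₂ c₁ c₂ d₁ d₂ D q : Carrier
      a₁ = re a
      a₂ = im a
      b₁ = re b
      b₂ = im b
      c₁ = re c
      c₂ = im c
      d₁ = a₁ * b₁ + a₂ * b₂ + - (β * c₁)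
      d₂ = a₁ * b₂ + - (a₂ * b₁) + β * c₂
      D  = d₁ * d₁ + d₂ * d₂
      q  = β * B + - ∣ b ∣²

    -- For α = x + iy the left side is 2 Re (α d). It is `bound` rearranged: the constant terms
    -- leave β A - |a|², which is zero.
    linear≤quadratic : ∀ x y →
      (x * d₁ + - (y * d₂)) + (x * d₁ + - (y * d₂)) ≤ (x * x + y * y) * q
    linear≤quadratic x y = by-nonNeg (gap (bound (x +i y))) (trans
      (solve 11 (λ a₁ a₂ b₁ b₂ c₁ c₂ A B β x y →
        let d₁ = a₁ :* b₁ :+ a₂ :* b₂ :- β :* c₁
            d₂ = a₁ :* b₂ :- a₂ :* b₁ :+ β :* c₂
            l  = x :* d₁ :- y :* d₂
            r  = x :* c₁ :- (:- y) :* c₂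
            e₁ = a₁ :+ (x :* b₁ :- y :* b₂)
            e₂ = a₂ :+ (x :* b₂ :+ y :* b₁)
            n  = x :* x :+ y :* y
        in β :* (A :+ (r :+ r) :+ n :* B) :- (e₁ :* e₁ :+ e₂ :* e₂) :+ (l :+ l)
             := n :* (β :* B :- (b₁ :* b₁ :+ b₂ :* b₂))
                :+ (β :* A :- (a₁ :* a₁ :+ a₂ :* a₂)))
        refl a₁ a₂ b₁ b₂ c₁ c₂ A B β x y)
      (trans (+-congˡ (trans (+-congʳ βA≈∣a∣²)
                (solve 1 (λ x → x :- x := con ℤ.0ℤ) refl ∣ a ∣²)))
             (+-identityʳ _)))

    private
      D≈0 : D ≈ 0#
      D≈0 = linear≤quadratic⇒zero (+-nonNeg (square-nonNeg d₁) (square-nonNeg d₂)) (gap ∣b∣²≤βB)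
        λ t → ≤-respˡ-≈
          (solve 3 (λ t d₁ d₂ → let l = t :* d₁ :* d₁ :- (:- (t :* d₂)) :* d₂
                                    D = d₁ :* d₁ :+ d₂ :* d₂
                                in l :+ l := t :* D :+ t :* D) refl t d₁ d₂)
          (≤-respʳ-≈
            (solve 4 (λ t d₁ d₂ q → (t :* d₁ :* (t :* d₁) :+ (:- (t :* d₂)) :* (:- (t :* d₂))) :* q
                                 := t :* t :* (d₁ :* d₁ :+ d₂ :* d₂) :* q) refl t d₁ d₂ q)
            (linear≤quadratic (t * d₁) (- (t * d₂))))

      d≈0 : d₁ ≈ 0# × d₂ ≈ 0#
      d≈0 = sum-of-squares-zero (≤-reflexive D≈0)

    optimal⇒proportional : a *ᶜ conj c ≈ᶜ b *ᶜ fromℝ A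
    optimal⇒proportional with em {P = β ≈ 0#}
    ... | yes β≈0 = trans (proj₁ ac̄≈0) (sym (proj₁ bA≈0)) , trans (proj₂ ac̄≈0) (sym (proj₂ bA≈0))
      where
      *ᶜ-zeroˡ : ∀ {z} → ∣ z ∣² ≤ 0# → ∀ u → z *ᶜ u ≈ᶜ 0ᶜ
      *ᶜ-zeroˡ {z} ∣z∣²≤0 u =
        let re≈0 , im≈0 = sum-of-squares-zero ∣z∣²≤0
        in trans (+-cong (*-congʳ re≈0) (-‿cong (*-congʳ im≈0)))
                 (solve 2 (λ x y → con ℤ.0ℤ :* x :- con ℤ.0ℤ :* y := con ℤ.0ℤ) refl (re u) (im u))
         , trans (+-cong (*-congʳ re≈0) (*-congʳ im≈0))
                 (solve 2 (λ x y → con ℤ.0ℤ :* y :+ con ℤ.0ℤ :* x := con ℤ.0ℤ) refl (re u) (im u))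
      ac̄≈0 : a *ᶜ conj c ≈ᶜ 0ᶜ
      ac̄≈0 = *ᶜ-zeroˡ (≤-reflexive (trans (sym βA≈∣a∣²) (trans (*-congʳ β≈0) (zeroˡ A)))) (conj c)
      bA≈0 : b *ᶜ fromℝ A ≈ᶜ 0ᶜ
      bA≈0 = *ᶜ-zeroˡ (≤-respʳ-≈ (trans (*-congʳ β≈0) (zeroˡ B)) ∣b∣²≤βB) (fromℝ A)
    ... | no β≉0 =
      -- The two components of the identity β (a conj c - b A) = -a d - b (β A - |a|²). Its right
      -- side vanishes because d = 0 and β A = |a|².
      *-cancelˡ β≉0 (cancel (trans
        (solve 8 (λ a₁ a₂ b₁ b₂ c₁ c₂ A β →
          β :* (a₁ :* c₁ :- a₂ :* (:- c₂)) :- β :* (b₁ :* A :- b₂ :* con ℤ.0ℤ)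
            := a₂ :* (a₁ :* b₂ :- a₂ :* b₁ :+ β :* c₂) :- a₁ :* (a₁ :* b₁ :+ a₂ :* b₂ :- β :* c₁)
               :- b₁ :* (β :* A :- (a₁ :* a₁ :+ a₂ :* a₂)))
          refl a₁ a₂ b₁ b₂ c₁ c₂ A β)
        (vanish (proj₂ d≈0) (proj₁ d≈0)))) ,
      *-cancelˡ β≉0 (cancel (trans
        (solve 8 (λ a₁ a₂ b₁ b₂ c₁ c₂ A β →
          β :* (a₁ :* (:- c₂) :+ a₂ :* c₁) :- β :* (b₁ :* con ℤ.0ℤ :+ b₂ :* A)
            := (:- a₂) :* (a₁ :* b₁ :+ a₂ :* b₂ :- β :* c₁) :- a₁ :* (a₁ :* b₂ :- a₂ :* b₁ :+ β :* c₂)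
               :- b₂ :* (β :* A :- (a₁ :* a₁ :+ a₂ :* a₂)))
          refl a₁ a₂ b₁ b₂ c₁ c₂ A β)
        (vanish (proj₁ d≈0) (proj₂ d≈0))))
      where
      cancel : ∀ {x y} → x + - y ≈ 0# → x ≈ y
      cancel {x} {y} x-y≈0 = trans (solve 2 (λ x y → x := x :- y :+ y) refl x y)
                                   (trans (+-congʳ x-y≈0) (+-identityˡ y))
      vanish : ∀ {r s x y z} → x ≈ 0# → y ≈ 0# →
        r * x + - (s * y) + - (z * (β * A + - ∣ a ∣²)) ≈ 0#
      vanish {r} {s} {z = z} x≈0 y≈0 = trans
        (+-cong (+-cong (*-congˡ x≈0) (-‿cong (*-congˡ y≈0)))
                (-‿cong (*-congˡ (+-congʳ βA≈∣a∣²))))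
        (solve 4 (λ r s z n → r :* con ℤ.0ℤ :- s :* con ℤ.0ℤ :- z :* (n :- n) := con ℤ.0ℤ)
          refl r s z ∣ a ∣²)

-- Bounds for z conj u by squared moduli

module ModulusBounds {ℓ : Level} (em : ExcludedMiddle ℓ) (ℝ : Reals ℓ) where
  open OrderedField em ℝ
  open Complex ℝ

  ∣_∣²-nonNeg : ∀ z → 0# ≤ ∣ z ∣²
  ∣ z ∣²-nonNeg = +-nonNeg (square-nonNeg (re z)) (square-nonNeg (im z))

  -- The expression separates into the form x² + y² + xy at the real parts of `z` and `u` and the
  -- same form at their imaginary parts.
  re-product-bound : ∀ z u → 0# ≤ ∣ z ∣² + ∣ u ∣² + re (z *ᶜ conj u)
  re-product-bound (a +i b) (c +i d) = ≤-respʳ-≈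
    (solve 4 (λ a b c d → a :* a :+ c :* c :+ a :* c :+ (b :* b :+ d :* d :+ b :* d)
                       := a :* a :+ b :* b :+ (c :* c :+ d :* d) :+ (a :* c :- b :* (:- d)))
      refl a b c d)
    (+-nonNeg (quadratic-nonNeg a c) (quadratic-nonNeg b d))

  -- This is the preceding bound with -u for u. The bounds for the imaginary part use iu and -iu
  -- likewise: the modulus is kept, and Re (z conj (iu)) = Im (z conj u).
  -re-product-bound : ∀ z u → 0# ≤ ∣ z ∣² + ∣ u ∣² + - re (z *ᶜ conj u)
  -re-product-bound (a +i b) (c +i d) = ≤-respʳ-≈
    (solve 4 (λ a b c d → a :* a :+ b :* b :+ ((:- c) :* (:- c) :+ (:- d) :* (:- d))
                            :+ (a :* (:- c) :- b :* (:- (:- d)))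
                       := a :* a :+ b :* b :+ (c :* c :+ d :* d) :- (a :* c :- b :* (:- d)))
      refl a b c d)
    (re-product-bound (a +i b) ((- c) +i (- d)))

  im-product-bound : ∀ z u → 0# ≤ ∣ z ∣² + ∣ u ∣² + im (z *ᶜ conj u)
  im-product-bound (a +i b) (c +i d) = ≤-respʳ-≈
    (solve 4 (λ a b c d → a :* a :+ b :* b :+ ((:- d) :* (:- d) :+ c :* c)
                            :+ (a :* (:- d) :- b :* (:- c))
                       := a :* a :+ b :* b :+ (c :* c :+ d :* d) :+ (a :* (:- d) :+ b :* c))
      refl a b c d)
    (re-product-bound (a +i b) ((- d) +i c))

  -im-product-bound : ∀ z u → 0# ≤ ∣ z ∣² + ∣ u ∣² + - im (z *ᶜ conj u)
  -im-product-bound (a +i b) (c +i d) = ≤-respʳ-≈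
    (solve 4 (λ a b c d → a :* a :+ b :* b :+ (d :* d :+ (:- c) :* (:- c))
                            :+ (a :* d :- b :* (:- (:- c)))
                       := a :* a :+ b :* b :+ (c :* c :+ d :* d) :- (a :* (:- d) :+ b :* c))
      refl a b c d)
    (re-product-bound (a +i b) (d +i (- c)))

-- Weighted means of real functions

module WeightedMeans {ℓ : Level} (em : ExcludedMiddle ℓ) (ℝ : Reals ℓ) {G : Set ℓ}
  (L : G → Complex.ℂ ℝ) (w : G → Reals.Carrier ℝ)
  (0≤w : ∀ π → Reals._≤_ ℝ (Reals.0# ℝ) (w π))
  (w≉0 : ¬ (∀ π → Reals._≈_ ℝ (w π) (Reals.0# ℝ)))
  (w-summable : Complex.Summable ℝ (λ π → Complex.fromℝ ℝ (w π))) where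
  open OrderedField em ℝ
  open Complex ℝ
  open Nets em ℝ {G}
  open ComplexSums em ℝ {G}
  open ModulusBounds em ℝ
  open Weighted em ℝ L w

  Wᶜ : ℂ
  Wᶜ = ∑ em (λ π → fromℝ (w π))

  W : Carrier
  W = re Wᶜ

  w-sums : Sums w W
  w-sums = proj₁ (hasSum⇒sums (hasSum-∑ w-summable))

  imWᶜ≈0 : im Wᶜ ≈ 0#
  imWᶜ≈0 = sums-unique (λ _ → refl) (proj₂ (hasSum⇒sums (hasSum-∑ w-summable)))
    (sums-zero (λ _ → refl))

  -- Every weight is at most the total, so a zero total would make all weights zero.
  0<W : 0# < W
  0<W = sums-nonNeg 0≤w w-sums ,
    λ 0≈W → w≉0 λ π → antisym (≤-respʳ-≈ (sym 0≈W) (term≤sum 0≤w w-sums π)) (0≤w π)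

  -- A mean described without division, by its total `W * m`: linearity comes straight from sums,
  -- and uniqueness from cancelling `W`. As a record type it lets `f` and `m` be found by
  -- unification.
  record Mean (f : G → Carrier) (m : Carrier) : Set ℓ where
    constructor mean
    field
      weighted-sums : Sums (λ π → w π * f π) (W * m)

  mean-cong : ∀ {f g m n} → (∀ π → f π ≈ g π) → m ≈ n → Mean f m → Mean g n
  mean-cong f≈g m≈n (mean Σf) = mean (sums-cong (λ π → *-congˡ (f≈g π)) (*-congˡ m≈n) Σf)

  mean-unique : ∀ {f g m n} → (∀ π → f π ≈ g π) → Mean f m → Mean g n → m ≈ n
  mean-unique f≈g (mean Σf) (mean Σg) =
    *-cancelˡ (pos≉0 0<W) (sums-unique (λ π → *-congˡ (f≈g π)) Σf Σg)

  mean-+ : ∀ {f g m n} → Mean f m → Mean g n → Mean (λ π → f π + g π) (m + n)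
  mean-+ (mean Σf) (mean Σg) = mean
    (sums-cong (λ π → sym (distribˡ (w π) _ _)) (sym (distribˡ W _ _)) (sums-+ Σf Σg))

  mean-* : ∀ c {f m} → Mean f m → Mean (λ π → c * f π) (c * m)
  mean-* c {f} {m} (mean Σf) = mean
    (sums-cong (λ π → exchange (w π) (f π)) (exchange W m) (sums-* c Σf))
    where
    exchange : ∀ x y → c * (x * y) ≈ x * (c * y)
    exchange x y = solve 3 (λ c x y → c :* (x :* y) := x :* (c :* y)) refl c x y

  mean-nonNeg : ∀ {f m} → (∀ π → 0# ≤ f π) → Mean f m → 0# ≤ m
  mean-nonNeg 0≤f (mean Σf) =
    *-nonNeg-cancelˡ 0<W (sums-nonNeg (λ π → *-nonNeg (0≤w π) (0≤f π)) Σf)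

  mean-zero : ∀ {f m} → (∀ π → w π * f π ≈ 0#) → Mean f m → m ≈ 0#
  mean-zero wf≈0 (mean Σf) =
    *-zero-cancelˡ (pos≉0 0<W) (sums-unique (λ _ → refl) Σf (sums-zero wf≈0))

  -- Complex means and their existence

  record Integrable (f : G → ℂ) : Set ℓ where
    constructor integrable
    field
      {re-total im-total} : Carrier
      re-sums : Sums (λ π → w π * re (f π)) re-total
      im-sums : Sums (λ π → w π * im (f π)) im-total

  record Meanᶜ (f : G → ℂ) (z : ℂ) : Set ℓ where
    constructor meanᶜ
    field
      re-mean : Mean (λ π → re (f π)) (re z)
      im-mean : Mean (λ π → im (f π)) (im z)
  open Meanᶜ

  -- The quotient in `𝔼` multiplies `S` by conj `Wᶜ` and by r = 1 / |`Wᶜ`|². Since `Wᶜ` has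
  -- imaginary part zero, W² r = 1, and multiplying the quotient by `W` gives back `S`.
  meanᶜ-𝔼 : (f : G → ℂ) → Integrable f → Meanᶜ f (𝔼 f)
  meanᶜ-𝔼 f (integrable re→ im→) = meanᶜ
    (mean (sums-cong re-wf (sym (trans
      (solve 5 (λ W V r s t → W :* ((s :* W :- t :* (:- V)) :* r :- (s :* (:- V) :+ t :* W) :* con ℤ.0ℤ)
                           := s :* (W :* W :* r) :+ W :* t :* r :* V) refl W (im Wᶜ) r (re S) (im S))
      (simplify (re S)))) (proj₁ wf→S)))
    (mean (sums-cong im-wf (sym (trans
      (solve 5 (λ W V r s t → W :* ((s :* W :- t :* (:- V)) :* con ℤ.0ℤ :+ (s :* (:- V) :+ t :* W) :* r)
                           := t :* (W :* W :* r) :+ (:- (W :* s :* r)) :* V) refl W (im Wᶜ) r (re S) (im S))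
      (simplify (im S)))) (proj₂ wf→S)))
    where
    re-wf : ∀ π → re (fromℝ (w π) *ᶜ f π) ≈ w π * re (f π)
    re-wf π = solve 3 (λ w x y → w :* x :- con ℤ.0ℤ :* y := w :* x) refl (w π) (re (f π)) (im (f π))
    im-wf : ∀ π → im (fromℝ (w π) *ᶜ f π) ≈ w π * im (f π)
    im-wf π = solve 3 (λ w x y → w :* y :+ con ℤ.0ℤ :* x := w :* y) refl (w π) (re (f π)) (im (f π))

    S : ℂ
    S = ∑ em (λ π → fromℝ (w π) *ᶜ f π)
    wf→S : Sums (λ π → re (fromℝ (w π) *ᶜ f π)) (re S) × Sums (λ π → im (fromℝ (w π) *ᶜ f π)) (im S)
    wf→S = hasSum⇒sums (hasSum-∑ (_ , sums⇒hasSum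
      (sums-cong (λ π → sym (re-wf π)) refl re→) (sums-cong (λ π → sym (im-wf π)) refl im→)))

    r : Carrier
    r = ∣ Wᶜ ∣² ⁻¹
    ∣Wᶜ∣²≈W² : ∣ Wᶜ ∣² ≈ W * W
    ∣Wᶜ∣²≈W² = trans (+-congˡ (trans (*-congʳ imWᶜ≈0) (zeroˡ _))) (+-identityʳ _)
    W²r≈1 : W * W * r ≈ 1#
    W²r≈1 = trans (*-congʳ (sym ∣Wᶜ∣²≈W²))
      (*-inverseʳ _ λ ∣Wᶜ∣²≈0 → pos≉0 (*-pos 0<W 0<W) (trans (sym ∣Wᶜ∣²≈W²) ∣Wᶜ∣²≈0))

    simplify : ∀ s {t} → s * (W * W * r) + t * im Wᶜ ≈ s
    simplify s {t} = trans
      (+-cong (trans (*-congˡ W²r≈1) (*-identityʳ s)) (trans (*-congˡ imWᶜ≈0) (zeroʳ t)))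
      (+-identityʳ s)

  dominated⇒weighted-sums : ∀ {f g : G → Carrier} {t} → Sums (λ π → w π * g π) t →
    (∀ π → 0# ≤ g π + f π) → (∀ π → 0# ≤ g π + - f π) → ∃ (Sums λ π → w π * f π)
  dominated⇒weighted-sums {f} {g} Σwg 0≤g+f 0≤g-f = dominated⇒sums
    (λ π → ≤-respʳ-≈ (distribˡ (w π) (g π) (f π)) (*-nonNeg (0≤w π) (0≤g+f π)))
    (λ π → ≤-respʳ-≈ (solve 3 (λ w g f → w :* (g :- f) := w :* g :- w :* f) refl (w π) (g π) (f π))
                     (*-nonNeg (0≤w π) (0≤g-f π)))
    Σwg

  record SquareSummable (z : G → ℂ) : Set ℓ where
    constructor squareSums
    field
      {total} : Carrier
      sums : Sums (λ π → w π * ∣ z π ∣²) total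

  squareSummable : ∀ {z} → Summable (λ π → fromℝ (w π * ∣ z π ∣²)) → SquareSummable z
  squareSummable (_ , w∣z∣²→s) = squareSums (proj₁ (hasSum⇒sums w∣z∣²→s))

  -- Both components of z conj u lie between -(|z|² + |u|²) and |z|² + |u|², whose weighted series
  -- converges.
  product-integrable : (z u : G → ℂ) → SquareSummable z → SquareSummable u →
    Integrable (λ π → z π *ᶜ conj (u π))
  product-integrable z u (squareSums {s} Σw∣z∣²) (squareSums {t} Σw∣u∣²) = integrable
    (proj₂ (dominated⇒weighted-sums
      {λ π → re (z π *ᶜ conj (u π))} {λ π → ∣ z π ∣² + ∣ u π ∣²} w[∣z∣²+∣u∣²]
      (λ π → re-product-bound (z π) (u π)) (λ π → -re-product-bound (z π) (u π))))
    (proj₂ (dominated⇒weighted-sums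
      {λ π → im (z π *ᶜ conj (u π))} {λ π → ∣ z π ∣² + ∣ u π ∣²} w[∣z∣²+∣u∣²]
      (λ π → im-product-bound (z π) (u π)) (λ π → -im-product-bound (z π) (u π))))
    where
    w[∣z∣²+∣u∣²] : Sums (λ π → w π * (∣ z π ∣² + ∣ u π ∣²)) (s + t)
    w[∣z∣²+∣u∣²] = sums-cong (λ π → sym (distribˡ (w π) _ _)) refl (sums-+ Σw∣z∣² Σw∣u∣²)

  meanᶜ-product : (z u : G → ℂ) → SquareSummable z → SquareSummable u →
    Meanᶜ (λ π → z π *ᶜ conj (u π)) (𝔼 (λ π → z π *ᶜ conj (u π)))
  meanᶜ-product z u zs us = meanᶜ-𝔼 (λ π → z π *ᶜ conj (u π)) (product-integrable z u zs us)

  1-squareSummable : SquareSummable (λ _ → fromℝ 1#)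
  1-squareSummable = squareSums (sums-cong
    (λ π → solve 1 (λ w → w := w :* (con ℤ.1ℤ :* con ℤ.1ℤ :+ con ℤ.0ℤ :* con ℤ.0ℤ)) refl (w π))
    refl w-sums)

  -- The case u = 1 of the product: the constant 1 is square summable because the weights are
  -- summable.
  squareSummable⇒integrable : (z : G → ℂ) → SquareSummable z → Integrable z
  squareSummable⇒integrable z zs = cancel-1 (product-integrable z (λ _ → fromℝ 1#) zs 1-squareSummable)
    where
    cancel-1 : Integrable (λ π → z π *ᶜ conj (fromℝ 1#)) → Integrable z
    cancel-1 (integrable re→ im→) = integrable
      (sums-cong (λ π → solve 3
        (λ w a b → w :* (a :* con ℤ.1ℤ :- b :* (:- con ℤ.0ℤ)) := w :* a) refl (w π) (re (z π)) (im (z π)))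
        refl re→)
      (sums-cong (λ π → solve 3
        (λ w a b → w :* (a :* (:- con ℤ.0ℤ) :+ b :* con ℤ.1ℤ) := w :* b) refl (w π) (re (z π)) (im (z π)))
        refl im→)

  -- First and second moments of a single function

  module _ (M : G → ℂ) (LM : SquareSummable (λ π → L π *ᶜ M π)) where

    private
      L*M : G → ℂ
      L*M π = L π *ᶜ M π

    Ψ-mean : Meanᶜ L*M (Ψ M)
    Ψ-mean = meanᶜ-𝔼 L*M (squareSummable⇒integrable L*M LM)

    ∣LM∣²-mean : Mean (λ π → ∣ L*M π ∣²) (re (Ψ₂ M M))
    ∣LM∣²-mean = mean-cong
      (λ π → solve 2 (λ x y → x :* x :- y :* (:- y) := x :* x :+ y :* y) refl
               (re (L*M π)) (im (L*M π)))
      refl (re-mean (meanᶜ-product L*M L*M LM LM))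

    Ψ₂-real : im (Ψ₂ M M) ≈ 0#
    Ψ₂-real = mean-zero
      (λ π → solve 3 (λ w x y → w :* (x :* (:- y) :+ y :* x) := con ℤ.0ℤ) refl
               (w π) (re (L*M π)) (im (L*M π)))
      (im-mean (meanᶜ-product L*M L*M LM LM))

    Ψ₂-nonNeg : 0# ≤ re (Ψ₂ M M)
    Ψ₂-nonNeg = mean-nonNeg {λ π → ∣ L*M π ∣²} (λ π → ∣ L*M π ∣²-nonNeg) ∣LM∣²-mean

    -- If the mean of |LM|² vanishes, then so does every term w |LM|², hence every term w LM.
    Ψ₂-zero⇒Ψ-zero : re (Ψ₂ M M) ≈ 0# → ∣ Ψ M ∣² ≈ 0#
    Ψ₂-zero⇒Ψ-zero Ψ₂≈0 = trans
      (+-cong (*-congʳ (mean-zero (λ π → proj₁ (terms-zero π)) (re-mean Ψ-mean)))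
              (*-congʳ (mean-zero (λ π → proj₂ (terms-zero π)) (im-mean Ψ-mean))))
      (trans (+-cong (zeroˡ _) (zeroˡ _)) (+-identityˡ 0#))
      where
      terms-zero : ∀ π → w π * re (L*M π) ≈ 0# × w π * im (L*M π) ≈ 0#
      terms-zero π with em {P = w π ≈ 0#}
      ... | yes w≈0 = trans (*-congʳ w≈0) (zeroˡ _) , trans (*-congʳ w≈0) (zeroˡ _)
      ... | no  w≉0 = trans (*-congˡ (proj₁ LM≈0)) (zeroʳ _) , trans (*-congˡ (proj₂ LM≈0)) (zeroʳ _)
        where
        0≤w∣LM∣² : ∀ π → 0# ≤ w π * ∣ L*M π ∣²
        0≤w∣LM∣² π = *-nonNeg (0≤w π) ∣ L*M π ∣²-nonNeg
        LM≈0 : re (L*M π) ≈ 0# × im (L*M π) ≈ 0#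
        LM≈0 = sum-of-squares-zero (≤-reflexive (*-zero-cancelˡ w≉0 (antisym
          (≤-respʳ-≈ (trans (*-congˡ Ψ₂≈0) (zeroʳ W)) (term≤sum 0≤w∣LM∣² (Mean.weighted-sums ∣LM∣²-mean) π))
          (0≤w∣LM∣² π))))

    -- The division-free form of `β`. Where `β` is 0 by convention, Ψ_M vanishes as well. Otherwise
    -- Ψ_{M,M} is nonzero with imaginary part zero, so its real part can be inverted.
    β*Ψ₂ : β M * re (Ψ₂ M M) ≈ ∣ Ψ M ∣²
    β*Ψ₂ with em {P = Ψ₂ M M ≈ᶜ 0ᶜ}
    ... | yes (Ψ₂≈0 , _) = trans (zeroˡ _) (sym (Ψ₂-zero⇒Ψ-zero Ψ₂≈0))
    ... | no  Ψ₂≉0 = trans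
      (solve 3 (λ x y z → x :* y :* z := x :* (z :* y)) refl ∣ Ψ M ∣² (re (Ψ₂ M M) ⁻¹) (re (Ψ₂ M M)))
      (trans (*-congˡ (*-inverseʳ _ λ re≈0 → Ψ₂≉0 (re≈0 , Ψ₂-real))) (*-identityʳ _))

  -- Expansion of the moments at M + αN

  module _ (M N : G → ℂ) (α : ℂ)
    (LM : SquareSummable (λ π → L π *ᶜ M π)) (LN : SquareSummable (λ π → L π *ᶜ N π))
    (LK : SquareSummable (λ π → L π *ᶜ (M π +ᶜ α *ᶜ N π))) where

    private
      K : G → ℂ
      K π = M π +ᶜ α *ᶜ N π

      re-LK : ∀ π → re (L π *ᶜ M π) + (re α * re (L π *ᶜ N π) + - im α * im (L π *ᶜ N π))
                    ≈ re (L π *ᶜ K π)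
      re-LK π = solve 8 (λ l l′ m m′ n n′ a a′ →
        (l :* m :- l′ :* m′) :+ (a :* (l :* n :- l′ :* n′) :+ (:- a′) :* (l :* n′ :+ l′ :* n))
          := l :* (m :+ (a :* n :- a′ :* n′)) :- l′ :* (m′ :+ (a :* n′ :+ a′ :* n)))
        refl (re (L π)) (im (L π)) (re (M π)) (im (M π)) (re (N π)) (im (N π)) (re α) (im α)

      im-LK : ∀ π → im (L π *ᶜ M π) + (re α * im (L π *ᶜ N π) + im α * re (L π *ᶜ N π))
                    ≈ im (L π *ᶜ K π)
      im-LK π = solve 8 (λ l l′ m m′ n n′ a a′ →
        (l :* m′ :+ l′ :* m) :+ (a :* (l :* n′ :+ l′ :* n) :+ a′ :* (l :* n :- l′ :* n′))
          := l :* (m′ :+ (a :* n′ :+ a′ :* n)) :+ l′ :* (m :+ (a :* n :- a′ :* n′)))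
        refl (re (L π)) (im (L π)) (re (M π)) (im (M π)) (re (N π)) (im (N π)) (re α) (im α)

    -- Pointwise LK = LM + α LN, so each component of the right side is a mean of the matching
    -- component of LK; a function has only one mean.
    Ψ-linear : Ψ K ≈ᶜ Ψ M +ᶜ α *ᶜ Ψ N
    Ψ-linear =
      trans (sym (mean-unique re-LK
        (mean-+ (re-mean (Ψ-mean M LM)) (mean-+ (mean-* (re α) (re-mean (Ψ-mean N LN)))
                                            (mean-* (- im α) (im-mean (Ψ-mean N LN)))))
        (re-mean (Ψ-mean K LK))))
        (solve 5 (λ m n n′ a a′ → m :+ (a :* n :+ (:- a′) :* n′) := m :+ (a :* n :- a′ :* n′))
          refl (re (Ψ M)) (re (Ψ N)) (im (Ψ N)) (re α) (im α)) ,
      sym (mean-unique im-LK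
        (mean-+ (im-mean (Ψ-mean M LM)) (mean-+ (mean-* (re α) (im-mean (Ψ-mean N LN)))
                                            (mean-* (im α) (re-mean (Ψ-mean N LN)))))
        (im-mean (Ψ-mean K LK)))

    -- The mean of |u + αv|² = |u|² + 2 Re (conj α u conj v) + |α|² |v|² at u = LM and v = LN.
    Ψ₂-expand : re (Ψ₂ K K) ≈ re (Ψ₂ M M) + (re (conj α *ᶜ Ψ₂ M N) + re (conj α *ᶜ Ψ₂ M N))
                                + ∣ α ∣² * re (Ψ₂ N N)
    Ψ₂-expand = sym (mean-unique
      (λ π → trans
        -- Here `p` and `p′` are the components of LM conj (LN), and `k` and `k′` those of LK, as
        -- delivered by `re-LK` and `im-LK`.
        (solve 6 (λ m m′ n n′ a a′ →
          let p  = m :* n :- m′ :* (:- n′)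
              p′ = m :* (:- n′) :+ m′ :* n
              r  = a :* p :+ a′ :* p′
              k  = m :+ (a :* n :+ (:- a′) :* n′)
              k′ = m′ :+ (a :* n′ :+ a′ :* n)
          in m :* m :+ m′ :* m′ :+ (r :+ r) :+ (a :* a :+ a′ :* a′) :* (n :* n :+ n′ :* n′)
               := k :* k :+ k′ :* k′)
          refl (re (L π *ᶜ M π)) (im (L π *ᶜ M π)) (re (L π *ᶜ N π)) (im (L π *ᶜ N π)) (re α) (im α))
        (+-cong (*-cong (re-LK π) (re-LK π)) (*-cong (im-LK π) (im-LK π))))
      -- Linearity of the mean gives Re (conj α c) as a c + a′ c′; the product formula reads a c -
      -- (-a′) c′.
      (mean-cong (λ _ → refl)
        (solve 6 (λ A B c c′ a a′ →
          let r = a :* c :+ a′ :* c′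
              s = a :* c :- (:- a′) :* c′
              n = a :* a :+ a′ :* a′
          in A :+ (r :+ r) :+ n :* B := A :+ (s :+ s) :+ n :* B)
          refl (re (Ψ₂ M M)) (re (Ψ₂ N N)) (re (Ψ₂ M N)) (im (Ψ₂ M N)) (re α) (im α))
        (mean-+ (mean-+ (∣LM∣²-mean M LM) (mean-+ Re[ᾱΨ₂] Re[ᾱΨ₂])) (mean-* ∣ α ∣² (∣LM∣²-mean N LN))))
      (∣LM∣²-mean K LK))
      where
      LMLN̄ : Meanᶜ (λ π → L π *ᶜ M π *ᶜ conj (L π *ᶜ N π)) (Ψ₂ M N)
      LMLN̄ = meanᶜ-product (λ π → L π *ᶜ M π) (λ π → L π *ᶜ N π) LM LN
      Re[ᾱΨ₂] : Mean (λ π → re α * re (L π *ᶜ M π *ᶜ conj (L π *ᶜ N π))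
                            + im α * im (L π *ᶜ M π *ᶜ conj (L π *ᶜ N π)))
                     (re α * re (Ψ₂ M N) + im α * im (Ψ₂ M N))
      Re[ᾱΨ₂] = mean-+ (mean-* (re α) (re-mean LMLN̄)) (mean-* (im α) (im-mean LMLN̄))

-- The optimality condition for maximisers of β

corollary2p7 :
    ∀ {ℓ p : Level} (em : ExcludedMiddle ℓ) (ℝ : Reals ℓ) →
    let open Reals ℝ
        open Complex ℝ in
    (G : Set ℓ) (L : G → ℂ) (w : G → Carrier) →
    (∀ π → 0# ≤ w π) →
    ¬ (∀ π → w π ≈ 0#) →
    let open Weighted em ℝ L w in
    (C : (G → ℂ) → Set p) →
    Summable (λ π → fromℝ (w π)) →
    (∀ M → C M → Summable (λ π → fromℝ (w π * ∣ L π *ᶜ M π ∣²))) →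
    (∀ M N → C M → C N → ∀ α → C (λ π → M π +ᶜ α *ᶜ N π)) →
    ∀ M → C M →
    (∀ N → C N → β N ≤ β M) →
    ∀ N → C N → Ψ M *ᶜ conj (Ψ₂ M N) ≈ᶜ Ψ N *ᶜ Ψ₂ M M
corollary2p7 em ℝ G L w 0≤w w≉0 C w-summable square-summable closed M M∈C maximal N N∈C =
  -- `proportional` has the real part of Ψ_{M,M} on its right side. The imaginary part is zero, so
  -- it may be put back.
  trans (proj₁ proportional) (+-congˡ (-‿cong (*-congˡ (sym (Ψ₂-real M LM))))) ,
  trans (proj₂ proportional) (+-congʳ (*-congˡ (sym (Ψ₂-real M LM))))
  where
  open OrderedField em ℝ
  open Complex ℝ
  open Weighted em ℝ L w
  open WeightedMeans em ℝ L w 0≤w w≉0 w-summable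
  open Optimality em ℝ

  square : ∀ {N} → C N → SquareSummable (λ π → L π *ᶜ N π)
  square {N} N∈C = squareSummable {λ π → L π *ᶜ N π} (square-summable N N∈C)

  LM : SquareSummable (λ π → L π *ᶜ M π)
  LM = square {M} M∈C

  -- Maximality multiplied by Ψ_{N,N} ≥ 0, with β(N) Ψ_{N,N} = |Ψ_N|². This form also covers
  -- functions with Ψ_{N,N} = 0.
  ∣Ψ∣²≤βΨ₂ : ∀ {N} → C N → ∣ Ψ N ∣² ≤ β M * re (Ψ₂ N N)
  ∣Ψ∣²≤βΨ₂ {N} N∈C = ≤-respˡ-≈ (trans (*-comm _ _) (β*Ψ₂ N (square {N} N∈C)))
    (≤-respʳ-≈ (*-comm _ _) (*-monoˡ-≤ (Ψ₂-nonNeg N (square {N} N∈C)) (maximal N N∈C)))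

  -- The preceding inequality at M + αN, which belongs to `C` by closure, with both moments expanded
  -- in α.
  bound : ∀ α → ∣ Ψ M +ᶜ α *ᶜ Ψ N ∣²
    ≤ β M * (re (Ψ₂ M M) + (re (conj α *ᶜ Ψ₂ M N) + re (conj α *ᶜ Ψ₂ M N)) + ∣ α ∣² * re (Ψ₂ N N))
  bound α =
    let K∈C = closed M N M∈C N∈C α
        LN  = square {N} N∈C
        LK  = square {λ π → M π +ᶜ α *ᶜ N π} K∈C
        re≈ , im≈ = Ψ-linear M N α LM LN LK
    in ≤-respˡ-≈ (+-cong (*-cong re≈ re≈) (*-cong im≈ im≈))
         (≤-respʳ-≈ (*-congˡ (Ψ₂-expand M N α LM LN LK)) (∣Ψ∣²≤βΨ₂ K∈C))

  proportional : Ψ M *ᶜ conj (Ψ₂ M N) ≈ᶜ Ψ N *ᶜ fromℝ (re (Ψ₂ M M))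
  proportional = optimal⇒proportional {Ψ M} {Ψ N} {Ψ₂ M N} {re (Ψ₂ M M)} {re (Ψ₂ N N)} {β M}
    (β*Ψ₂ M LM) (∣Ψ∣²≤βΨ₂ N∈C) bound
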